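{- Let $k\ge 2$, let $H$ be a digraph (possibly with loops), and let $D$ be an $H$-colored local in-tournament. If every directed cycle in $D$ has $H$-length at most $k-2$, then $D$ has a $(k,H)$-kernel.
   Context: All digraphs are finite. A local in-tournament is a digraph $D$ such that for every vertex $x$, the subdigraph induced by the in-neighbourhood $N^-(x)$ is a tournament (every two distinct vertices joined by exactly one arc). $D$ has no loops and comes with a map $\rho: A(D)\to V(H)$. For a walk $W=(x_0,\ldots,x_n)$ in $D$, there is an obstruction on $x_i$ if $(\rho(x_{i-1},x_i),\rho(x_i,x_{i+1})) \notin A(H)$; for an open walk this is considered at internal vertices $x_i$, $1\le i\le n-1$, for a closed walk (such as a cycle) at all $i\in\{0,\ldots,n-1\}$ with indices modulo $n$. $O_H(W)$ is the set of indices with an obstruction; the $H$-length is $l_H(W)=|O_H(W)|+1$ for open $W$ and $|O_H(W)|$ for closed $W$. A $(k,H)$-kernel ($k\ge2$) is a set $S\subseteq V(D)$ such that for every two distinct $u,v\in S$ every directed $uv$-path in $D$ has $H$-length at least $k$, and for every $x\in V(D)\setminus S$ there is a directed path from $x$ to a vertex of $S$ of $H$-length at most $k-1$. -}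

module Defs where

open import Data.Bool.Base using (Bool; not; T)
open import Data.Fin.Base using (Fin)
open import Data.Fin.Subset using (Subset; _∈_; _∉_; ∣_∣)
open import Data.List.Base using (List; []; _∷_; _∷ʳ_; length)
open import Data.List.Relation.Unary.Unique.Propositional using (Unique)
open import Data.Nat.Base using (ℕ; suc; pred; _≤_; _∸_)
open import Data.Product.Base using (_×_; ∃-syntax)
open import Data.Sum.Base using (_⊎_)
open import Data.Vec.Base using ([]; _∷_)
open import Relation.Binary.Construct.Closure.ReflexiveTransitive using (Star; ε; _◅_)
open import Relation.Binary.PropositionalEquality using (_≢_)
open import Relation.Nullary.Negation.Core using (¬_)

-- Loops and 2-cycles are allowed.
record Digraph : Set where
  field
    order : ℕ
    adj   : Fin order → Fin order → Bool

  Vertex : Set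
  Vertex = Fin order

  -- Arc u v has at most one inhabitant, so there are no parallel arcs.
  Arc : Vertex → Vertex → Set
  Arc u v = T (adj u v)

  Walk : Vertex → Vertex → Set
  Walk = Star Arc

  -- The starting points of the successive arcs: x₀, …, xₙ₋₁ for the walk
  -- (x₀, …, xₙ).
  sources : ∀ {u v} → Walk u v → List Vertex
  sources ε             = []
  sources (_◅_ {u} _ W) = u ∷ sources W

  vertices : ∀ {u v} → Walk u v → List Vertex
  vertices {v = v} W = sources W ∷ʳ v

  IsPath : ∀ {u v} → Walk u v → Set
  IsPath W = Unique (vertices W)

  -- In a loopless digraph such a walk automatically has length at least 2.
  IsCycle : ∀ {x} → Walk x x → Set
  IsCycle W = 1 ≤ length (sources W) × Unique (sources W)

  TournamentOn : (Vertex → Set) → Set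
  TournamentOn P = ∀ u v → P u → P v → u ≢ v →
    (Arc u v × ¬ Arc v u) ⊎ (¬ Arc u v × Arc v u)

  LocalInTournament : Set
  LocalInTournament = ∀ x → TournamentOn (λ u → Arc u x)

record ColouredDigraph (H : Digraph) : Set where
  field
    digraph : Digraph

  open Digraph digraph public

  field
    loopless : ∀ v → ¬ Arc v v
    ρ        : ∀ u v → Arc u v → Digraph.Vertex H

-- For the colours c₀, …, cₙ₋₁ of the arcs of an open walk (x₀, …, xₙ), the
-- set of its obstructed internal vertices; position i stands for xᵢ₊₁, which
-- lies between the arcs coloured cᵢ and cᵢ₊₁.
obstructions : (H : Digraph) (cs : List (Digraph.Vertex H)) →
               Subset (pred (length cs))
obstructions H []           = []
obstructions H (c ∷ [])     = []
obstructions H (c ∷ d ∷ cs) = not (Digraph.adj H c d) ∷ obstructions H (d ∷ cs)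

-- For a closed walk, repeating the first colour at the end makes
-- positions 0, …, n-1 of obstructions stand for x₁, …, xₙ, where xₙ = x₀.
closeUp : ∀ {A : Set} → List A → List A
closeUp []       = []
closeUp (c ∷ cs) = (c ∷ cs) ∷ʳ c

module _ {H : Digraph} (D : ColouredDigraph H) where
  open ColouredDigraph D

  colours : ∀ {u v} → Walk u v → List (Digraph.Vertex H)
  colours ε                 = []
  colours (_◅_ {u} {v} a W) = ρ u v a ∷ colours W

  openLength : ∀ {u v} → Walk u v → ℕ
  openLength W = suc ∣ obstructions H (colours W) ∣

  closedLength : ∀ {x} → Walk x x → ℕ
  closedLength W = ∣ obstructions H (closeUp (colours W)) ∣

  Independent : ℕ → Subset order → Set
  Independent k S = ∀ u v → u ∈ S → v ∈ S → u ≢ v →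
    (W : Walk u v) → IsPath W → k ≤ openLength W

  Absorbent : ℕ → Subset order → Set
  Absorbent l S = ∀ x → x ∉ S →
    ∃[ s ] s ∈ S × (∃[ W ] IsPath {x} {s} W × openLength W ≤ l)

  IsKernel : ℕ → Subset order → Set
  IsKernel k S = Independent k S × Absorbent (k ∸ 1) S

{-# OPTIONS --safe #-}

-- Call x tied to y when x reaches y by a path of H-length at most k - 1; a
-- (k,H)-kernel is a kernel of the relation "tied". In a local in-tournament a
-- cycle C can be enlarged by any vertex v that has an arc into C and is
-- reachable from C: going backwards along C from the head of that arc, each
-- vertex of C is comparable with v, so either v can be inserted into C, or v
-- dominates C, and then a path from C to v closes up with C. Hence any two
-- mutually reachable vertices lie on a common cycle, and the bound on the
-- H-length of cycles makes them tied to each other. A greedy choice along a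
-- linearisation of the reachability preorder, sinks first, then gives a kernel.
module Submission where

open import Defs
open import Data.Bool.Base using (true; false; T)
open import Data.Fin.Base using (Fin; zero; suc)
open import Data.Fin.Properties using (_≟_; any?; injective⇒≤)
open import Data.Fin.Subset using (Subset; _∈_; _∪_; ⁅_⁆; ⊥; ∣_∣)
open import Data.Fin.Subset.Properties
  using (_∈?_; ∉⊥; x∈⁅x⁆; x∈⁅y⁆⇒x≡y; x∈p∪q⁻; x∈p∪q⁺)
open import Data.List.Base using (List; []; _∷_; _++_; _∷ʳ_; length; lookup; allFin)
open import Data.List.Properties using (++-assoc)
open import Data.List.Membership.Propositional using (find) renaming (_∈_ to _∈ₗ_; _∉_ to _∉ₗ_)
open import Data.List.Membership.Propositional.Properties
  using (∈-++⁺ˡ; ∈-++⁺ʳ; ∈-++⁻; ∈-allFin; ∈-lookup)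
import Data.List.Membership.DecPropositional as DecMembership
open import Data.List.Relation.Binary.Disjoint.Propositional using (Disjoint)
open import Data.List.Relation.Binary.Permutation.Propositional
  using (_↭_; prep; swap; ↭-refl; ↭-reflexive; ↭-sym; ↭-trans; ↭⇒↭ₛ)
open import Data.List.Relation.Binary.Permutation.Propositional.Properties
  using (All-resp-↭; ∈-resp-↭; ++-comm; ++⁺ˡ; shift)
import Data.List.Relation.Binary.Permutation.Setoid.Properties as Permutationₛ
open import Data.List.Relation.Unary.All as All using (All; []; _∷_)
open import Data.List.Relation.Unary.All.Properties using (¬Any⇒All¬)
open import Data.List.Relation.Unary.AllPairs using (AllPairs; []; _∷_)
open import Data.List.Relation.Unary.Any as Any using (Any; here; there)
open import Data.List.Relation.Unary.Unique.Propositional using (Unique)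
open import Data.List.Relation.Unary.Unique.Propositional.Properties
  using (Unique[x∷xs]⇒x∉xs) renaming (++⁺ to Unique-++⁺)
open import Data.List.Relation.Unary.Unique.DecPropositional using (unique?)
open import Data.Nat.Base using (ℕ; zero; suc; _∸_; _≤_; z≤n; s≤s)
open import Data.Nat.Properties using (≤-trans; _≤?_; ≰⇒>)
open import Data.Product.Base using (Σ-syntax; ∃-syntax; _×_; _,_; proj₁)
open import Data.Sum.Base using (_⊎_; inj₁; inj₂; [_,_]′)
open import Function.Base using (_∘_; id)
open import Level using (0ℓ)
open import Relation.Binary.Construct.Closure.ReflexiveTransitive using (ε; _◅_; _◅◅_)
open import Relation.Binary.Core using (Rel)
import Relation.Binary.Definitions as B
open import Relation.Binary.PropositionalEquality
  using (_≡_; _≢_; refl; sym; trans; cong; subst; setoid; ≢-sym)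
open import Relation.Nullary.Decidable using (Dec; yes; no; map′; _×-dec_; _⊎-dec_)
open import Relation.Nullary.Negation using (¬_; contradiction)
open import Relation.Unary using (Decidable)

-- Lists without repetitions

module _ {A : Set} where

  Unique-resp-↭ : {xs ys : List A} → xs ↭ ys → Unique xs → Unique ys
  Unique-resp-↭ p = Permutationₛ.Unique-resp-↭ (setoid A) (↭⇒↭ₛ p)

  Unique-++⁻ʳ : (xs : List A) {ys : List A} → Unique (xs ++ ys) → Unique ys
  Unique-++⁻ʳ []       u       = u
  Unique-++⁻ʳ (x ∷ xs) (_ ∷ u) = Unique-++⁻ʳ xs u

  Unique-++⁻ˡ : (xs : List A) {ys : List A} → Unique (xs ++ ys) → Unique xs
  Unique-++⁻ˡ xs {ys} u = Unique-++⁻ʳ ys (Unique-resp-↭ (++-comm xs ys) u)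

  Unique-∷ : {x : A} {xs : List A} → x ∉ₗ xs → Unique xs → Unique (x ∷ xs)
  Unique-∷ x∉xs u = ¬Any⇒All¬ _ x∉xs ∷ u

  lookup-injective : {xs : List A} → Unique xs → ∀ {i j} → lookup xs i ≡ lookup xs j → i ≡ j
  lookup-injective {x ∷ xs} _       {zero}  {zero}  _  = refl
  lookup-injective {x ∷ xs} u       {zero}  {suc j} eq =
    contradiction (subst (_∈ₗ xs) (sym eq) (∈-lookup j)) (Unique[x∷xs]⇒x∉xs u)
  lookup-injective {x ∷ xs} u       {suc i} {zero}  eq =
    contradiction (subst (_∈ₗ xs) eq (∈-lookup i)) (Unique[x∷xs]⇒x∉xs u)
  lookup-injective {x ∷ xs} (_ ∷ u) {suc i} {suc j} eq = cong suc (lookup-injective u eq)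

-- Pigeonhole: `lookup` embeds the positions of `xs` into `Fin n`.
Unique⇒length≤ : ∀ {n} {xs : List (Fin n)} → Unique xs → length xs ≤ n
Unique⇒length≤ u = injective⇒≤ (lookup-injective u)

ΣT? : ∀ b {P : T b → Set} → Decidable P → Dec (Σ[ t ∈ T b ] P t)
ΣT? false P? = no λ ()
ΣT? true  P? = map′ (_ ,_) (λ (_ , p) → p) (P? _)

-- Kernels of relations on a finite preorder

module _ {n : ℕ} {_⇝_ : Rel (Fin n) 0ℓ}
         (⇝-trans : B.Transitive _⇝_) (_⇝?_ : B.Decidable _⇝_) where

  -- Sources come first: a later entry reaches an earlier one only if the two are mutually
  -- reachable. A recursion that treats the tail first thus meets the sinks first.
  Linearised : List (Fin n) → Set
  Linearised = AllPairs λ x y → y ⇝ x → x ⇝ y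

  -- The new entry goes right behind the last entry that reaches it. If `y` is passed over, some `w`
  -- at or behind `y` reaches `x`; then `x ⇝ y` gives `w ⇝ y`, hence `y ⇝ w` by linearity, and so
  -- `y ⇝ x`.
  insert : ∀ x {ys} → Linearised ys → ∃[ zs ] x ∷ ys ↭ zs × Linearised zs
  insert x {ys} lin with Any.any? (_⇝? x) ys
  insert x {ys}     lin         | no  none = x ∷ ys , ↭-refl ,
    All.map (λ ¬y⇝x y⇝x → contradiction y⇝x ¬y⇝x) (¬Any⇒All¬ _ none) ∷ lin
  insert x {y ∷ ys} (y≼ys ∷ lin) | yes some with insert x lin
  ... | zs , p , lin′ = y ∷ zs , ↭-trans (swap x y ↭-refl) (prep y p) ,
    All-resp-↭ p (y≼x some ∷ y≼ys) ∷ lin′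
    where
    y≼x : Any (_⇝ x) (y ∷ ys) → x ⇝ y → y ⇝ x
    y≼x (here y⇝x)  _   = y⇝x
    y≼x (there any) x⇝y with w , w∈ys , w⇝x ← find any =
      ⇝-trans (All.lookup y≼ys w∈ys (⇝-trans w⇝x x⇝y)) w⇝x

  linearise : ∀ xs → ∃[ ys ] xs ↭ ys × Linearised ys
  linearise []       = [] , ↭-refl , []
  linearise (x ∷ xs) with linearise xs
  ... | ys , p , lin with insert x lin
  ... | zs , q , lin′ = zs , ↭-trans (prep x p) q , lin′

  module _ {_↝_ : Rel (Fin n) 0ℓ} (_↝?_ : B.Decidable _↝_)
           (↝⇒⇝ : ∀ {x y} → x ↝ y → x ⇝ y)
           (mutual⇒↝ : ∀ {x y} → x ≢ y → x ⇝ y → y ⇝ x → x ↝ y) where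

    -- The first clause lets the induction apply the linearity of the list to members of `S`.
    KernelOf : List (Fin n) → Subset n → Set
    KernelOf xs S =
      (∀ {s} → s ∈ S → s ∈ₗ xs) ×
      (∀ {s t} → s ∈ S → t ∈ S → s ≢ t → ¬ s ↝ t) ×
      (∀ {x} → x ∈ₗ xs → x ∈ S ⊎ ∃[ s ] s ∈ S × x ↝ s)

    -- Greedy choice: the head joins `S` exactly when `S` does not already absorb it.
    linearised⇒kernel : ∀ {xs} → Linearised xs → ∃[ S ] KernelOf xs S
    linearised⇒kernel []                   =
      ⊥ , (λ s∈⊥ → contradiction s∈⊥ ∉⊥) , (λ s∈⊥ → contradiction s∈⊥ ∉⊥) , λ ()
    linearised⇒kernel {x ∷ xs} (x≼xs ∷ lin) with linearised⇒kernel lin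
    ... | S , S⊆xs , indep , absorb with any? (λ s → (s ∈? S) ×-dec (x ↝? s))
    ... | yes absorbed = S , there ∘ S⊆xs , indep ,
      λ { (here refl) → inj₂ absorbed ; (there y∈xs) → absorb y∈xs }
    ... | no ¬absorbed = S ∪ ⁅ x ⁆ , S′⊆ , indep′ , absorb′
      where
      split : ∀ {s} → s ∈ S ∪ ⁅ x ⁆ → s ∈ S ⊎ s ≡ x
      split s∈ = [ inj₁ , inj₂ ∘ x∈⁅y⁆⇒x≡y x ]′ (x∈p∪q⁻ S ⁅ x ⁆ s∈)

      S′⊆ : ∀ {s} → s ∈ S ∪ ⁅ x ⁆ → s ∈ₗ x ∷ xs
      S′⊆ s∈ = [ there ∘ S⊆xs , here ]′ (split s∈)

      indep′ : ∀ {s t} → s ∈ S ∪ ⁅ x ⁆ → t ∈ S ∪ ⁅ x ⁆ → s ≢ t → ¬ s ↝ t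
      indep′ s∈ t∈ s≢t s↝t with split s∈ | split t∈
      ... | inj₁ s∈S  | inj₁ t∈S  = indep s∈S t∈S s≢t s↝t
      -- An earlier choice `s` with `s ↝ x` would be mutually reachable with `x`, so `x ↝ s`, and
      -- `x` would have been absorbed.
      ... | inj₁ s∈S  | inj₂ refl = ¬absorbed (_ , s∈S ,
        mutual⇒↝ (≢-sym s≢t) (All.lookup x≼xs (S⊆xs s∈S) (↝⇒⇝ s↝t)) (↝⇒⇝ s↝t))
      ... | inj₂ refl | inj₁ t∈S  = ¬absorbed (_ , t∈S , s↝t)
      ... | inj₂ refl | inj₂ refl = s≢t refl

      absorb′ : ∀ {y} → y ∈ₗ x ∷ xs → y ∈ S ∪ ⁅ x ⁆ ⊎ ∃[ s ] s ∈ S ∪ ⁅ x ⁆ × y ↝ s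
      absorb′ (here refl)  = inj₁ (x∈p∪q⁺ (inj₂ (x∈⁅x⁆ x)))
      absorb′ (there y∈xs) with absorb y∈xs
      ... | inj₁ y∈S             = inj₁ (x∈p∪q⁺ (inj₁ y∈S))
      ... | inj₂ (s , s∈S , y↝s) = inj₂ (s , x∈p∪q⁺ (inj₁ s∈S) , y↝s)

    kernel : ∃[ S ] (∀ {s t} → s ∈ S → t ∈ S → s ≢ t → ¬ s ↝ t) ×
                    (∀ x → x ∈ S ⊎ ∃[ s ] s ∈ S × x ↝ s)
    kernel with linearise (allFin n)
    ... | _ , p , lin with linearised⇒kernel lin
    ... | S , _ , indep , absorb = S , indep , λ x → absorb (∈-resp-↭ p (∈-allFin x))

-- Walks, paths and cycles

module _ (D : Digraph) where
  open Digraph D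
  open DecMembership (_≟_ {order}) using () renaming (_∈?_ to _∈ₗ?_)

  sources-◅◅ : ∀ {u v w} (V : Walk u v) (W : Walk v w) →
               sources (V ◅◅ W) ≡ sources V ++ sources W
  sources-◅◅ ε       W = refl
  sources-◅◅ (_ ◅ V) W = cong (_ ∷_) (sources-◅◅ V W)

  splitAt : ∀ {u v c} (W : Walk u v) → c ∈ₗ sources W →
            ∃[ d ] Σ[ V₁ ∈ Walk u c ] Σ[ a ∈ Arc c d ] Σ[ V₂ ∈ Walk d v ] W ≡ V₁ ◅◅ a ◅ V₂
  splitAt (a ◅ W) (here refl) = _ , ε , a , W , refl
  splitAt (a ◅ W) (there c∈W) with splitAt W c∈W
  ... | _ , V₁ , b , V₂ , refl = _ , a ◅ V₁ , b , V₂ , refl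

  -- Loop erasure: if `u` recurs on the path found for the rest, only the part from that recurrence
  -- on is kept.
  walk⇒path : ∀ {u v} → Walk u v → ∃[ W ] IsPath {u} {v} W
  walk⇒path ε = ε , [] ∷ []
  walk⇒path {u} (a ◅ W) with walk⇒path W
  ... | P , unq with u ∈ₗ? vertices P
  ... | no  u∉P = a ◅ P , Unique-∷ u∉P unq
  ... | yes u∈P with ∈-++⁻ (sources P) u∈P
  ... | inj₂ (here refl) = ε , [] ∷ []
  ... | inj₁ u∈P with splitAt P u∈P
  ... | _ , V₁ , b , V₂ , refl = b ◅ V₂ , Unique-++⁻ʳ (sources V₁)
    (subst Unique (trans (cong (_∷ʳ _) (sources-◅◅ V₁ (b ◅ V₂)))
                         (++-assoc (sources V₁) _ _)) unq)

  path-length≤ : ∀ {u v} (W : Walk u v) → IsPath W → length (sources W) ≤ order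
  path-length≤ W unq = Unique⇒length≤ (Unique-++⁻ˡ (sources W) unq)

  -- The search branches on the first arc. Since `P` is an arbitrary predicate on walks, the arc
  -- already chosen can be absorbed into it.
  shortWalk? : ∀ m {u v} {P : Walk u v → Set} → Decidable P →
               Dec (∃[ W ] length (sources W) ≤ m × P W)
  shortWalk? m {u} {v} {P} P? = map′
    (λ { (inj₁ (refl , p)) → ε , z≤n , p
       ; (inj₂ s) → nonempty m s })
    (λ { (ε , _ , p) → inj₁ (refl , p)
       ; (a ◅ W , l , p) → inj₂ (nonempty⁻ m a W l p) })
    (trivial? ⊎-dec nonempty? m)
    where
    Trivial : Set
    Trivial = Σ[ eq ∈ u ≡ v ] P (subst (Walk u) eq ε)

    trivial? : Dec Trivial
    trivial? with u ≟ v
    ... | yes refl = map′ (refl ,_) (λ { (refl , p) → p }) (P? ε)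
    ... | no  u≢v  = no (u≢v ∘ proj₁)

    Nonempty : ℕ → Set
    Nonempty zero    = Fin 0
    Nonempty (suc m) = ∃[ w ] Σ[ a ∈ Arc u w ] Σ[ W ∈ Walk w v ]
                       length (sources W) ≤ m × P (a ◅ W)

    nonempty : ∀ m → Nonempty m → ∃[ W ] length (sources W) ≤ m × P W
    nonempty (suc m) (w , a , W , l , p) = a ◅ W , s≤s l , p

    nonempty⁻ : ∀ m {w} (a : Arc u w) (W : Walk w v) →
                length (sources (a ◅ W)) ≤ m → P (a ◅ W) → Nonempty m
    nonempty⁻ (suc m) a W (s≤s l) p = _ , a , W , l , p

    nonempty? : ∀ m → Dec (Nonempty m)
    nonempty? zero    = no λ ()
    nonempty? (suc m) = any? λ w → ΣT? (adj u w) λ a → shortWalk? m (P? ∘ (a ◅_))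

  -- The sources of a path are distinct, so a search up to length `order` misses none.
  path? : ∀ {u v} {P : Walk u v → Set} → Decidable P → Dec (∃[ W ] IsPath W × P W)
  path? P? = map′ (λ (W , _ , p) → W , p) (λ (W , unq , p) → W , path-length≤ W unq , unq , p)
    (shortWalk? order λ W → unique? _≟_ (vertices W) ×-dec P? W)

  walk? : B.Decidable Walk
  walk? u v = map′ proj₁ (λ W → let P , unq = walk⇒path W in P , unq , _)
    (path? {P = λ _ → T true} λ _ → yes _)

  -- The base point of a closed walk moves to `c` by exchanging the two pieces on either side of it.
  rotate : ∀ {x c} (W : Walk x x) → c ∈ₗ sources W →
           ∃[ d ] Σ[ a ∈ Arc c d ] Σ[ V ∈ Walk d c ] sources W ↭ c ∷ sources V
  rotate W c∈W with splitAt W c∈W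
  ... | d , V₁ , a , V₂ , refl = d , a , V₂ ◅◅ V₁ , ↭-trans
    (↭-reflexive (sources-◅◅ V₁ (a ◅ V₂)))
    (↭-trans (++-comm (sources V₁) (_ ∷ sources V₂))
             (↭-reflexive (sym (sources-◅◅ (a ◅ V₂) V₁))))

  -- Enlarging cycles in a local in-tournament

  module _ (lit : LocalInTournament) where

    -- Induction from the end of `W`: for an arc from `x` to `y` with `v` also dominating `y`, the
    -- in-neighbours `x` and `v` of `y` are adjacent. Either `v` fits between `x` and `y`, or `v`
    -- dominates `x` and the comparison moves one step back.
    insert-or-dominate : ∀ {x z} v (W : Walk x z) → v ∉ₗ sources W → Arc v z →
      (Σ[ W′ ∈ Walk x z ] sources W′ ↭ v ∷ sources W) ⊎
      (Arc v x × All (Arc v) (sources W))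
    insert-or-dominate v ε _ v→z = inj₂ (v→z , [])
    insert-or-dominate {x} v (_◅_ {j = y} a W) v∉ v→z
      with insert-or-dominate v W (v∉ ∘ there) v→z
    ... | inj₁ (W′ , p) = inj₁ (a ◅ W′ , ↭-trans (prep x p) (swap x v ↭-refl))
    ... | inj₂ (v→y , dom) with lit y x v a v→y (λ { refl → v∉ (here refl) })
    ... | inj₁ (x→v , _) = inj₁ (x→v ◅ v→y ◅ W , swap x v ↭-refl)
    ... | inj₂ (_ , v→x) = inj₂ (v→x , v→x ∷ dom)

    -- The walk Q starts just after the last visit of P to C.
    exit : ∀ {u v} {C : List Vertex} (P : Walk u v) → IsPath P → v ∉ₗ C →
      Disjoint (vertices P) C ⊎
      ∃[ c ] c ∈ₗ C × ∃[ y ] Arc c y × Σ[ Q ∈ Walk y v ] IsPath Q × Disjoint (vertices Q) C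
    exit ε _ v∉C = inj₁ λ { (here refl , v∈C) → v∉C v∈C }
    exit {u} {C = C} (a ◅ P) (_ ∷ unq) v∉C with exit P unq v∉C
    ... | inj₂ e = inj₂ e
    ... | inj₁ disj with u ∈ₗ? C
    ... | yes u∈C = inj₂ (u , u∈C , _ , a , P , unq , disj)
    ... | no  u∉C = inj₁ λ { (here refl , u∈C) → u∉C u∈C ; (there w∈P , w∈C) → disj (w∈P , w∈C) }

    CycleThrough : List Vertex → Set
    CycleThrough xs = ∃[ x ] Σ[ W ∈ Walk x x ]
      Unique (sources W) × (∀ {y} → y ∈ₗ xs → y ∈ₗ sources W)

    -- If `v` cannot be inserted, it dominates the whole cycle, so a path from the cycle to `v` may
    -- re-enter the cycle at any vertex.
    enlarge-cycle : ∀ {x c v} (W : Walk x x) → Unique (sources W) → c ∈ₗ sources W →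
      v ∉ₗ sources W → Arc v c → Walk c v → CycleThrough (v ∷ sources W)
    enlarge-cycle {c = c} {v} W unq c∈W v∉W v→c Q with rotate W c∈W
    ... | d , a , V , p with insert-or-dominate v (a ◅ V) (v∉W ∘ ∈-resp-↭ (↭-sym p)) v→c
    ... | inj₁ (W′ , q) = c , W′ ,
      Unique-resp-↭ (↭-sym r) (Unique-∷ v∉W unq) , ∈-resp-↭ (↭-sym r)
      where r = ↭-trans q (prep v (↭-sym p))
    ... | inj₂ (_ , dom) with P , unqP ← walk⇒path Q with exit {C = sources W} P unqP v∉W
    ... | inj₁ disj = contradiction (start∈ P , c∈W) disj
      where
      start∈ : ∀ {u w} (P : Walk u w) → u ∈ₗ vertices P
      start∈ ε       = here refl
      start∈ (_ ◅ _) = here refl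
    ... | inj₂ (b , b∈W , y , b→y , R , unqR , disj) with rotate W b∈W
    -- The detour leaves the cycle at `b` and re-enters at the successor `e` of `b`, so no vertex of
    -- the old cycle is skipped.
    ... | e , b→e , U , q = b , b→y ◅ R ◅◅ v→e ◅ U ,
      Unique-resp-↭ r (Unique-++⁺ unqR unq disj) , ∈-resp-↭ r ∘ v∷W⊆
      where
      dominates : ∀ {w} → w ∈ₗ sources W → Arc v w
      dominates w∈W = All.lookup dom (∈-resp-↭ p w∈W)

      second∈ : ∀ {e} (U : Walk e b) → e ∈ₗ b ∷ sources U
      -- If `U` is empty, the cycle is a loop and `e` is `b` itself.
      second∈ ε       = here refl
      second∈ (_ ◅ _) = there (here refl)

      v→e : Arc v e
      v→e = dominates (∈-resp-↭ (↭-sym q) (second∈ U))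

      r : vertices R ++ sources W ↭ sources (b→y ◅ R ◅◅ v→e ◅ U)
      r rewrite sources-◅◅ R (v→e ◅ U) | sym (++-assoc (sources R) (v ∷ []) (sources U)) =
        ↭-trans (++⁺ˡ (vertices R) q) (shift b (vertices R) (sources U))

      v∷W⊆ : ∀ {w} → w ∈ₗ v ∷ sources W → w ∈ₗ vertices R ++ sources W
      v∷W⊆ (here refl)  = ∈-++⁺ˡ (∈-++⁺ʳ (sources R) (here refl))
      v∷W⊆ (there w∈W) = ∈-++⁺ʳ (vertices R) w∈W

    -- Behind the first arc, the rest of the closed walk is reduced to a path back to `x`.
    cycle-through-start : ∀ {x y} → Walk x y → Walk y x → x ≢ y → CycleThrough (x ∷ [])
    cycle-through-start ε       _ x≢x = contradiction refl x≢x
    cycle-through-start {x} (a ◅ W) V _ with walk⇒path (W ◅◅ V)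
    ... | P , unq = x , a ◅ P ,
      Unique-resp-↭ (++-comm (sources P) (x ∷ [])) unq ,
      λ { (here refl) → here refl }

    -- Going backwards along P, each vertex is absorbed into the cycle in turn;
    -- it is reachable from the cycle through x.
    cycle-through-walk : ∀ {u x} (P : Walk u x) → Walk x u → CycleThrough (x ∷ []) →
                         CycleThrough (u ∷ x ∷ [])
    cycle-through-walk ε V (z , W , unq , x∈W) =
      z , W , unq , λ { (here refl) → x∈W (here refl) ; (there x∈) → x∈W x∈ }
    cycle-through-walk {u} (a ◅ P) V C with cycle-through-walk P (V ◅◅ a ◅ ε) C
    ... | z , W , unq , ⊆W with u ∈ₗ? sources W
    ... | yes u∈W = z , W , unq , λ { (here refl) → u∈W ; (there x∈) → ⊆W (there x∈) }
    ... | no  u∉W with enlarge-cycle W unq (⊆W (here refl)) u∉W a (P ◅◅ V)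
    ... | z′ , W′ , unq′ , ⊆W′ = z′ , W′ , unq′ ,
      λ { (here refl) → ⊆W′ (here refl) ; (there x∈) → ⊆W′ (there (⊆W (there x∈))) }

    -- The common cycle is cut at `x` and `y`. Displaying the arc `a` that leaves `y` puts `y`
    -- itself among the distinct sources, from which `V₁` is seen to be a path.
    cycle-through-both : ∀ {x y} → x ≢ y → Walk x y → Walk y x →
      ∃[ d ] Σ[ V₁ ∈ Walk x y ] Σ[ a ∈ Arc y d ] Σ[ V₂ ∈ Walk d x ] Unique (sources (V₁ ◅◅ a ◅ V₂))
    cycle-through-both x≢y V V′
      with cycle-through-walk V′ V (cycle-through-start V V′ x≢y)
    ... | _ , W , unq , ⊆W with rotate W (⊆W (there (here refl)))
    ... | _ , b , U , p with splitAt (b ◅ U) (∈-resp-↭ p (⊆W (here refl)))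
    ... | d , V₁ , a , V₂ , eq = d , V₁ , a , V₂ ,
      subst (Unique ∘ sources) eq (Unique-resp-↭ p unq)

-- H-length

module _ (H : Digraph) where

  obstructions-++ : ∀ cs ds → ∣ obstructions H cs ∣ ≤ ∣ obstructions H (cs ++ ds) ∣
  obstructions-++ []           ds = z≤n
  obstructions-++ (c ∷ [])     ds = z≤n
  obstructions-++ (c ∷ d ∷ cs) ds with Digraph.adj H c d | obstructions-++ (d ∷ cs) ds
  ... | true  | ih = ih
  ... | false | ih = s≤s ih

  obstructions-closeUp : ∀ cs ds → ∣ obstructions H cs ∣ ≤ ∣ obstructions H (closeUp (cs ++ ds)) ∣
  obstructions-closeUp []       ds = z≤n
  obstructions-closeUp (c ∷ cs) ds
    -- Up to associativity, closing up extends `c ∷ cs` on the right, which removes no obstruction.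
    rewrite ++-assoc cs ds (c ∷ []) = obstructions-++ (c ∷ cs) (ds ∷ʳ c)

module _ {H : Digraph} (D : ColouredDigraph H) where
  open ColouredDigraph D

  colours-◅◅ : ∀ {u v w} (V : Walk u v) (W : Walk v w) →
               colours D (V ◅◅ W) ≡ colours D V ++ colours D W
  colours-◅◅ ε       W = refl
  colours-◅◅ (_ ◅ V) W = cong (_ ∷_) (colours-◅◅ V W)

  openLength≤1+closedLength : ∀ {x y} (V : Walk x y) (W : Walk y x) →
                              openLength D V ≤ suc (closedLength D (V ◅◅ W))
  openLength≤1+closedLength V W rewrite colours-◅◅ V W =
    s≤s (obstructions-closeUp H (colours D V) (colours D W))

  -- The obstructions inside the segment `V₁` are also obstructions of the common cycle; the open
  -- length exceeds their number by one, whence `suc m`.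
  mutual⇒short-path : LocalInTournament → ∀ {m} →
    (∀ x (W : Walk x x) → IsCycle W → closedLength D W ≤ m) →
    ∀ {x y} → x ≢ y → Walk x y → Walk y x → ∃[ W ] IsPath {x} {y} W × openLength D W ≤ suc m
  mutual⇒short-path lit bound {x} {y} x≢y V V′
    with cycle-through-both digraph lit x≢y V V′
  ... | _ , V₁ , a , V₂ , unq = V₁ , isPath ,
    ≤-trans (openLength≤1+closedLength V₁ (a ◅ V₂))
            (s≤s (bound x (V₁ ◅◅ a ◅ V₂) (nonempty V₁ , unq)))
    where
    nonempty : ∀ {u} (V : Walk u y) → 1 ≤ length (sources (V ◅◅ a ◅ V₂))
    nonempty ε       = s≤s z≤n
    nonempty (_ ◅ _) = s≤s z≤n

    isPath : IsPath V₁
    isPath = Unique-++⁻ˡ (vertices V₁) (subst Unique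
      (trans (sources-◅◅ digraph V₁ (a ◅ V₂)) (sym (++-assoc (sources V₁) _ _))) unq)

theorem27 : (k : ℕ) → 2 ≤ k → (H : Digraph) (D : ColouredDigraph H) →
    ColouredDigraph.LocalInTournament D →
    (∀ x (W : ColouredDigraph.Walk D x x) → ColouredDigraph.IsCycle D W → closedLength D W ≤ k ∸ 2) →
    ∃[ S ] IsKernel D k S
theorem27 (suc (suc k)) (s≤s (s≤s _)) H D lit bound
  -- After the match, `k` is two less than the given parameter: cycles are bounded by `k`, tied
  -- paths by `suc k`.
  with kernel _◅◅_ (walk? digraph) {λ x y → ∃[ W ] IsPath {x} {y} W × openLength D W ≤ suc k}
         (λ _ _ → path? digraph λ W → openLength D W ≤? suc k) proj₁ (mutual⇒short-path D lit bound)
  where open ColouredDigraph D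
... | S , indep , absorb = S , independent , absorbent
  where
  independent : Independent D (suc (suc k)) S
  independent u v u∈S v∈S u≢v W isPath = ≰⇒> λ short → indep u∈S v∈S u≢v (W , isPath , short)

  absorbent : Absorbent D (suc k) S
  absorbent x x∉S = [ (λ x∈S → contradiction x∈S x∉S) , id ]′ (absorb x)
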